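{- The following are equivalent: (i) Markov's Principle: $\forall\alpha\in\mathcal{N}[\neg\neg\exists n[\alpha(n)=0]\rightarrow\exists n[\alpha(n)=0]]$; (ii) for every $\beta$ with $Spr(\beta)$, every $\alpha\in\mathcal{F}_\beta$ that is not an isolated point of $\mathcal{F}_\beta$ is a limit point of $\mathcal{F}_\beta$.
   Context: Intuitionistic mathematics (constructive reading of logical constants). $\mathcal{N}=\omega^\omega$; finite sequences of naturals are coded by naturals, $\overline{\alpha}n=\langle\alpha(0),\dots,\alpha(n-1)\rangle$; for codes $s,t$, $s\sqsubset t$ means $s$ is an initial segment of $t$ and $s\sqsubset\alpha$ means $s=\overline{\alpha}n$ for some $n$; $s\perp\alpha$ means $s$ is not an initial segment of $\alpha$; $\alpha\perp\delta$ means $\exists n[\alpha(n)\neq\delta(n)]$. $\mathcal{F}_\beta:=\{\alpha\mid\forall n[\beta(\overline{\alpha}n)=0]\}$; $Spr(\beta)$ iff $\forall s[\beta(s)=0\leftrightarrow\exists n[\beta(s\ast\langle n\rangle)=0]]$. For $\alpha\in\mathcal{F}_\beta$: $\alpha$ is an isolated point iff $\exists n\forall\gamma\in\mathcal{F}_\beta[\overline{\alpha}n\sqsubset\gamma\rightarrow\alpha=\gamma]$; $\alpha$ is a limit point iff $\forall n\exists\delta\in\mathcal{F}_\beta[\overline{\alpha}n\sqsubset\delta\wedge\alpha\perp\delta]$. -}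

module Defs where

open import Data.Nat using (ℕ; zero; suc; _*_; _^_)
open import Data.Nat.Properties using (*-assoc; *-suc; +-identityʳ)
open import Data.List using (List; []; _∷_; _∷ʳ_; applyUpTo)
open import Data.Product using (∃; _×_)
open import Function.Bundles using (_⇔_)
open import Relation.Nullary using (¬_)
open import Relation.Binary.PropositionalEquality using (_≡_; _≢_; _≗_; refl; sym; trans; cong; module ≡-Reasoning)

𝒩 : Set
𝒩 = ℕ → ℕ

-- A bijective coding of finite sequences, read off from the fact that every
-- positive number is uniquely of the form 2 ^ x * (2 * c + 1).

code : List ℕ → ℕ
code []       = 0
code (x ∷ xs) = 2 ^ x * suc (2 * code xs)

incHead : List ℕ → List ℕ
incHead []       = []
incHead (x ∷ xs) = suc x ∷ xs

-- Successor with respect to codes: code (next xs) ≡ suc (code xs).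
next : List ℕ → List ℕ
next []           = 0 ∷ []
next (zero  ∷ xs) = incHead (next xs)
next (suc x ∷ xs) = 0 ∷ x ∷ xs

decode : ℕ → List ℕ
decode zero    = []
decode (suc n) = next (decode n)

code-incHead : ∀ xs → code (incHead xs) ≡ 2 * code xs
code-incHead []       = refl
code-incHead (x ∷ xs) = *-assoc 2 (2 ^ x) _

code-next : ∀ xs → code (next xs) ≡ suc (code xs)
code-next []           = refl
code-next (zero ∷ xs)  = begin
  code (incHead (next xs))      ≡⟨ code-incHead (next xs) ⟩
  2 * code (next xs)            ≡⟨ cong (2 *_) (code-next xs) ⟩
  2 * suc (code xs)             ≡⟨ *-suc 2 (code xs) ⟩
  suc (suc (2 * code xs))       ≡⟨ cong suc (sym (+-identityʳ _)) ⟩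
  suc (code (zero ∷ xs))        ∎
  where open ≡-Reasoning
code-next (suc x ∷ xs) = trans (+-identityʳ _) (cong suc (sym (*-assoc 2 (2 ^ x) _)))

code-decode : ∀ n → code (decode n) ≡ n
code-decode zero    = refl
code-decode (suc n) = trans (code-next (decode n)) (cong suc (code-decode n))

next-incHead : ∀ xs → next (incHead xs) ≡ 0 ∷ xs
next-incHead []       = refl
next-incHead (x ∷ xs) = refl

decode-double : ∀ n → decode (2 * n) ≡ incHead (decode n)
decode-double zero    = refl
decode-double (suc n) = begin
  decode (2 * suc n)                   ≡⟨ cong decode (*-suc 2 n) ⟩
  next (next (decode (2 * n)))         ≡⟨ cong (λ s → next (next s)) (decode-double n) ⟩
  next (next (incHead (decode n)))     ≡⟨ cong next (next-incHead (decode n)) ⟩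
  incHead (decode (suc n))             ∎
  where open ≡-Reasoning

decode-code : ∀ xs → decode (code xs) ≡ xs
decode-code []           = refl
decode-code (zero ∷ xs)  = begin
  decode (code (zero ∷ xs))         ≡⟨ cong decode (+-identityʳ (suc (2 * code xs))) ⟩
  next (decode (2 * code xs))       ≡⟨ cong next (decode-double (code xs)) ⟩
  next (incHead (decode (code xs))) ≡⟨ next-incHead _ ⟩
  0 ∷ decode (code xs)              ≡⟨ cong (0 ∷_) (decode-code xs) ⟩
  0 ∷ xs                            ∎
  where open ≡-Reasoning
decode-code (suc x ∷ xs) = begin
  decode (code (suc x ∷ xs))        ≡⟨ cong decode (*-assoc 2 (2 ^ x) _) ⟩
  decode (2 * code (x ∷ xs))        ≡⟨ decode-double (code (x ∷ xs)) ⟩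
  incHead (decode (code (x ∷ xs)))  ≡⟨ cong incHead (decode-code (x ∷ xs)) ⟩
  suc x ∷ xs                        ∎
  where open ≡-Reasoning

infixl 20 _∗⟨_⟩
_∗⟨_⟩ : ℕ → ℕ → ℕ
s ∗⟨ n ⟩ = code (decode s ∷ʳ n)

-- The code usually written α with an overbar, followed by n.
initial : 𝒩 → ℕ → ℕ
initial α n = code (applyUpTo α n)

infix 4 _⊏_ _⊥_

_⊏_ : ℕ → 𝒩 → Set
s ⊏ α = ∃ λ n → s ≡ initial α n

_⊥_ : 𝒩 → 𝒩 → Set
α ⊥ δ = ∃ λ n → α n ≢ δ n

infix 4 _∈𝓕_
_∈𝓕_ : 𝒩 → 𝒩 → Set
α ∈𝓕 β = ∀ n → β (initial α n) ≡ 0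

Spr : 𝒩 → Set
Spr β = ∀ s → β s ≡ 0 ⇔ (∃ λ n → β (s ∗⟨ n ⟩) ≡ 0)

-- Equality of elements of 𝒩 is extensional, hence _≗_.
IsolatedPoint : 𝒩 → 𝒩 → Set
IsolatedPoint β α = ∃ λ n → ∀ γ → γ ∈𝓕 β → initial α n ⊏ γ → α ≗ γ

LimitPoint : 𝒩 → 𝒩 → Set
LimitPoint β α = ∀ n → ∃ λ δ → δ ∈𝓕 β × initial α n ⊏ δ × α ⊥ δ

MarkovPrinciple : Set
MarkovPrinciple = (α : 𝒩) → ¬ ¬ (∃ λ n → α n ≡ 0) → ∃ λ n → α n ≡ 0

{-# OPTIONS --safe #-}

-- (i) ⇒ (ii): whether some admissible extension of the code of α(0),…,α(n-1)
-- leaves α is a Σ₁ question; if there is none, α is isolated.  So Markov's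
-- Principle finds one, and the spread law prolongs it to a point of 𝓕.
-- (ii) ⇒ (i): let 𝓕 consist of the γ that may only be nonzero at i once α has
-- had a zero at some k ≤ i.  The zero sequence is isolated in 𝓕 exactly if α
-- has no zero, and a point of 𝓕 apart from the zero sequence reveals one.
module Submission where

open import Defs
open import Data.Bool using (if_then_else_)
open import Data.Nat using (ℕ; zero; suc; _+_; _*_; _∸_; _≤_; _<_; z<s; s<s; _≟_)
open import Data.Nat.Properties
open import Data.List using (List; []; _∷_; _++_; _∷ʳ_; length; applyUpTo)
open import Data.List.Properties using (≡-dec; ∷-injectiveˡ; ∷-injectiveʳ; ∷ʳ-++; ++-identityʳ; length-applyUpTo; applyUpTo-∷ʳ)
open import Data.Product using (∃; _×_; _,_; proj₁; proj₂)
open import Data.Sum using (inj₁; inj₂)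
open import Function using (_∘_; const)
open import Function.Bundles using (_⇔_; mk⇔; module Equivalence)
open import Relation.Nullary using (¬_; Dec; yes; no; does; ¬?; contradiction; decidable-stable; _×-dec_)
open import Relation.Binary.PropositionalEquality using (_≡_; _≢_; refl; sym; trans; cong; cong₂; subst; module ≡-Reasoning)

code-injective : ∀ {xs ys} → code xs ≡ code ys → xs ≡ ys
code-injective {xs} {ys} eq = trans (sym (decode-code xs)) (trans (cong decode eq) (decode-code ys))

code-∗ : ∀ xs n → code xs ∗⟨ n ⟩ ≡ code (xs ∷ʳ n)
code-∗ xs n = cong (λ ys → code (ys ∷ʳ n)) (decode-code xs)

initial-∗ : ∀ α n → initial α n ∗⟨ α n ⟩ ≡ initial α (suc n)
initial-∗ α n = trans (code-∗ (applyUpTo α n) (α n)) (cong code (applyUpTo-∷ʳ α n))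

applyUpTo-cong-< : ∀ {f g : 𝒩} n → (∀ {i} → i < n → f i ≡ g i) → applyUpTo f n ≡ applyUpTo g n
applyUpTo-cong-< zero    eq = refl
applyUpTo-cong-< (suc n) eq = cong₂ _∷_ (eq z<s) (applyUpTo-cong-< n (eq ∘ s<s))

applyUpTo-≡⇒≡-< : ∀ {f g : 𝒩} n → applyUpTo f n ≡ applyUpTo g n → ∀ {i} → i < n → f i ≡ g i
applyUpTo-≡⇒≡-< (suc n) eq {zero}  _         = ∷-injectiveˡ eq
applyUpTo-≡⇒≡-< (suc n) eq {suc i} (s<s i<n) = applyUpTo-≡⇒≡-< n (∷-injectiveʳ eq) i<n

-- Only finitely many indices have to be compared and equality on `ℕ` is decidable, so an index of
-- difference is found without Markov's Principle.
applyUpTo-≢⇒⊥ : ∀ {f g : 𝒩} n → applyUpTo f n ≢ applyUpTo g n → f ⊥ g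
applyUpTo-≢⇒⊥         zero    neq = contradiction refl neq
applyUpTo-≢⇒⊥ {f} {g} (suc n) neq with f 0 ≟ g 0
... | no  f₀≢g₀ = 0 , f₀≢g₀
... | yes f₀≡g₀ with applyUpTo-≢⇒⊥ n (neq ∘ cong₂ _∷_ f₀≡g₀)
...   | i , fᵢ≢gᵢ = suc i , fᵢ≢gᵢ

applyUpTo-+ : ∀ (f : 𝒩) m n → applyUpTo f (m + n) ≡ applyUpTo f m ++ applyUpTo (f ∘ (m +_)) n
applyUpTo-+ f zero    n = refl
applyUpTo-+ f (suc m) n = cong (f 0 ∷_) (applyUpTo-+ (f ∘ suc) m n)

-- `_⊏_` leaves the length `m` of the segment open; injectivity of the code and a comparison of
-- lengths force it to be `n`.
initial-⊏ : ∀ {α γ} n → initial α n ⊏ γ → applyUpTo α n ≡ applyUpTo γ n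
initial-⊏ {α} {γ} n (m , eq) = trans segments≡ (cong (applyUpTo γ) (sym n≡m))
  where
  segments≡ : applyUpTo α n ≡ applyUpTo γ m
  segments≡ = code-injective eq

  n≡m : n ≡ m
  n≡m = trans (sym (length-applyUpTo α n)) (trans (cong length segments≡) (length-applyUpTo γ m))

infixr 5 _⌢_
_⌢_ : List ℕ → 𝒩 → 𝒩
([]       ⌢ τ) i       = τ i
((x ∷ xs) ⌢ τ) zero    = x
((x ∷ xs) ⌢ τ) (suc i) = (xs ⌢ τ) i

applyUpTo-⌢ : ∀ xs τ k → applyUpTo (xs ⌢ τ) (length xs + k) ≡ xs ++ applyUpTo τ k
applyUpTo-⌢ []       τ k = refl
applyUpTo-⌢ (x ∷ xs) τ k = cong (x ∷_) (applyUpTo-⌢ xs τ k)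

applyUpTo-⌢-prefix : ∀ xs ys τ → applyUpTo ((xs ++ ys) ⌢ τ) (length xs) ≡ xs
applyUpTo-⌢-prefix []       ys τ = refl
applyUpTo-⌢-prefix (x ∷ xs) ys τ = cong (x ∷_) (applyUpTo-⌢-prefix xs ys τ)

applyUpTo-⌢-length : ∀ xs τ → applyUpTo (xs ⌢ τ) (length xs) ≡ xs
applyUpTo-⌢-length xs τ =
  subst (λ ys → applyUpTo (ys ⌢ τ) (length xs) ≡ xs) (++-identityʳ xs) (applyUpTo-⌢-prefix xs [] τ)

module Spread {β : 𝒩} (spr : Spr β) where

  child : ∀ xs → β (code xs) ≡ 0 → ∃ λ n → β (code (xs ∷ʳ n)) ≡ 0
  child xs βxs with Equivalence.to (spr (code xs)) βxs
  ... | n , βxsn = n , trans (cong β (sym (code-∗ xs n))) βxsn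

  -- The backward half of the spread law removes one entry at a time, `k` times in all.
  initial-down : ∀ δ k {m} → β (initial δ (k + m)) ≡ 0 → β (initial δ m) ≡ 0
  initial-down δ zero    βδ = βδ
  initial-down δ (suc k) {m} βδ = initial-down δ k
    (Equivalence.from (spr (initial δ (k + m))) (δ (k + m) , trans (cong β (initial-∗ δ (k + m))) βδ))

  -- The spread law supplies the next entry as a component of a pair, so iterating it needs no
  -- choice principle.
  branch : ∀ xs → β (code xs) ≡ 0 → 𝒩
  branch xs βxs zero    = proj₁ (child xs βxs)
  branch xs βxs (suc i) = branch (xs ∷ʳ proj₁ (child xs βxs)) (proj₂ (child xs βxs)) i

  branch-admissible : ∀ xs βxs k → β (code (xs ++ applyUpTo (branch xs βxs) k)) ≡ 0
  branch-admissible xs βxs zero    = trans (cong (β ∘ code) (++-identityʳ xs)) βxs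
  branch-admissible xs βxs (suc k) =
    trans (cong (β ∘ code) (sym (∷ʳ-++ xs (proj₁ (child xs βxs)) _)))
          (branch-admissible (xs ∷ʳ proj₁ (child xs βxs)) (proj₂ (child xs βxs)) k)

  extend-∈𝓕 : ∀ xs βxs → (xs ⌢ branch xs βxs) ∈𝓕 β
  -- `branch-admissible` covers only segments that contain `xs`, and `m` may be smaller than
  -- `length xs`; hence the passage to length `length xs + m` and back down to `m`.
  extend-∈𝓕 xs βxs m = initial-down _ (length xs)
    (trans (cong (β ∘ code) (applyUpTo-⌢ xs (branch xs βxs) m)) (branch-admissible xs βxs m))

markov-dec : MarkovPrinciple → {P : ℕ → Set} → (∀ n → Dec (P n)) → ¬ ¬ ∃ P → ∃ P
markov-dec mp {P} P? ¬¬∃P =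
  let n , χn≡0 = mp χ (λ ∄ → ¬¬∃P λ (n , Pn) → ∄ (n , P⇒χ≡0 Pn)) in n , χ≡0⇒P χn≡0
  where
  χ : 𝒩
  χ n = if does (P? n) then 0 else 1

  P⇒χ≡0 : ∀ {n} → P n → χ n ≡ 0
  P⇒χ≡0 {n} Pn with P? n
  ... | yes _  = refl
  ... | no ¬Pn = contradiction Pn ¬Pn

  χ≡0⇒P : ∀ {n} → χ n ≡ 0 → P n
  χ≡0⇒P {n} eq with P? n
  ... | yes Pn = Pn

module _ (β α : 𝒩) (n : ℕ) where

  -- Both conditions concern a finite sequence and can be checked, which makes Markov's Principle
  -- applicable to the search for `ts`.
  Leaves : List ℕ → Set
  Leaves ts = β (code xs) ≡ 0 × applyUpTo α (length xs) ≢ xs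
    where xs = applyUpTo α n ++ ts

  leaves? : ∀ ts → Dec (Leaves ts)
  leaves? ts = (β _ ≟ 0) ×-dec ¬? (≡-dec _≟_ _ _)

  never-leaves⇒isolated : (∀ ts → ¬ Leaves ts) → IsolatedPoint β α
  -- Equality on `ℕ` is stable, so it suffices to refute a difference at `i`.
  never-leaves⇒isolated stays = n , λ γ γ∈𝓕 αn⊏γ i → decidable-stable (α i ≟ γ i) λ αᵢ≢γᵢ →
    let
      -- A segment of this length contains the index `i` and also splits at `n` into the part shared
      -- with `α` and `ts`.
      k = n + suc i
      ts = applyUpTo (γ ∘ (n +_)) (suc i)
      γk≡ : applyUpTo γ k ≡ applyUpTo α n ++ ts
      γk≡ = trans (applyUpTo-+ γ n (suc i)) (cong (_++ ts) (sym (initial-⊏ {α} n αn⊏γ)))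
      leaves-γ : applyUpTo α (length (applyUpTo γ k)) ≢ applyUpTo γ k
      leaves-γ eq = αᵢ≢γᵢ (applyUpTo-≡⇒≡-< k
        (trans (cong (applyUpTo α) (sym (length-applyUpTo γ k))) eq) (m≤n+m (suc i) n))
    in stays ts (subst (λ xs → β (code xs) ≡ 0 × applyUpTo α (length xs) ≢ xs) γk≡ (γ∈𝓕 k , leaves-γ))

  leaves⇒nearby-point : Spr β → ∀ ts → Leaves ts → ∃ λ δ → δ ∈𝓕 β × initial α n ⊏ δ × α ⊥ δ
  leaves⇒nearby-point spr ts (βxs , α≢xs) = xs ⌢ τ , extend-∈𝓕 xs βxs , (n , cong code (sym δn≡)) ,
    applyUpTo-≢⇒⊥ (length xs) λ eq → α≢xs (trans eq (applyUpTo-⌢-length xs τ))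
    where
    open Spread spr
    xs = applyUpTo α n ++ ts
    τ  = branch xs βxs

    δn≡ : applyUpTo (xs ⌢ τ) n ≡ applyUpTo α n
    δn≡ = trans (cong (applyUpTo (xs ⌢ τ)) (sym (length-applyUpTo α n)))
                (applyUpTo-⌢-prefix (applyUpTo α n) ts τ)

markov⇒limit : MarkovPrinciple → (β : 𝒩) → Spr β → (α : 𝒩) → α ∈𝓕 β → ¬ IsolatedPoint β α → LimitPoint β α
markov⇒limit mp β spr α _ ¬isolated n =
  -- Markov's Principle searches through natural numbers, so the lists `ts` are enumerated by
  -- `decode`, which is onto by `decode-code`.
  let c , leaves = markov-dec mp (leaves? β α n ∘ decode) ¬¬leaves
  in leaves⇒nearby-point β α n spr (decode c) leaves
  where
  ¬¬leaves : ¬ ¬ ∃ (Leaves β α n ∘ decode)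
  ¬¬leaves ∄ = ¬isolated (never-leaves⇒isolated β α n λ ts leaves →
    ∄ (code ts , subst (Leaves β α n) (sym (decode-code ts)) leaves))

-- A sum of products of naturals vanishes only if each product does, so weight 0 says in one
-- equation that every entry is zero or sits at a zero of `p`.
weight : 𝒩 → List ℕ → ℕ
weight p []       = 0
weight p (x ∷ xs) = x * p 0 + weight (p ∘ suc) xs

weight-∷ʳ : ∀ p xs x → weight p (xs ∷ʳ x) ≡ weight p xs + x * p (length xs)
weight-∷ʳ p []       x = +-comm (x * p 0) 0
weight-∷ʳ p (y ∷ xs) x =
  trans (cong (y * p 0 +_) (weight-∷ʳ (p ∘ suc) xs x)) (sym (+-assoc (y * p 0) _ _))

supportedOnZeros : 𝒩 → 𝒩
supportedOnZeros p s = weight p (decode s)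

-- Appending 0 adds no weight, and the weight of a sequence is a summand of the weight of each of
-- its children.
supportedOnZeros-spr : ∀ p → Spr (supportedOnZeros p)
supportedOnZeros-spr p s = mk⇔
  (λ eq → 0 , trans (weight-∗ 0) (trans (+-identityʳ _) eq))
  (λ (n , eq) → m+n≡0⇒m≡0 (weight p (decode s)) (trans (sym (weight-∗ n)) eq))
  where
  weight-∗ : ∀ n → supportedOnZeros p (s ∗⟨ n ⟩) ≡ weight p (decode s) + n * p (length (decode s))
  weight-∗ n = trans (cong (weight p) (decode-code (decode s ∷ʳ n))) (weight-∷ʳ p (decode s) n)

weight-applyUpTo : ∀ p γ → (∀ i → γ i * p i ≡ 0) → ∀ n → weight p (applyUpTo γ n) ≡ 0
weight-applyUpTo p γ eq zero    = refl
weight-applyUpTo p γ eq (suc n) = cong₂ _+_ (eq 0) (weight-applyUpTo (p ∘ suc) (γ ∘ suc) (eq ∘ suc) n)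

∈𝓕-supportedOnZeros⁺ : ∀ {p γ} → (∀ i → γ i * p i ≡ 0) → γ ∈𝓕 supportedOnZeros p
∈𝓕-supportedOnZeros⁺ {p} {γ} eq n =
  trans (cong (weight p) (decode-code (applyUpTo γ n))) (weight-applyUpTo p γ eq n)

-- The product at `i` is the last summand in the weight of the segment of length `suc i`.
∈𝓕-supportedOnZeros⁻ : ∀ {p γ} → γ ∈𝓕 supportedOnZeros p → ∀ i → γ i * p i ≡ 0
∈𝓕-supportedOnZeros⁻ {p} {γ} γ∈𝓕 i = m+n≡0⇒n≡0 (weight p (applyUpTo γ i)) (begin
  weight p (applyUpTo γ i) + γ i * p i
    ≡⟨ cong (λ k → weight p (applyUpTo γ i) + γ i * p k) (length-applyUpTo γ i) ⟨
  weight p (applyUpTo γ i) + γ i * p (length (applyUpTo γ i))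
    ≡⟨ weight-∷ʳ p (applyUpTo γ i) (γ i) ⟨
  weight p (applyUpTo γ i ∷ʳ γ i)
    ≡⟨ cong (weight p) (applyUpTo-∷ʳ γ i) ⟩
  weight p (applyUpTo γ (suc i))
    ≡⟨ cong (weight p) (decode-code (applyUpTo γ (suc i))) ⟨
  supportedOnZeros p (initial γ (suc i))
    ≡⟨ γ∈𝓕 (suc i) ⟩
  0 ∎)
  where open ≡-Reasoning

-- The products turn the zeros of `α` into an upward closed set: one zero of `α` permits nonzero
-- entries arbitrarily far out, so that the zero sequence is no longer isolated.
partialProduct : 𝒩 → 𝒩
partialProduct α zero    = α 0
partialProduct α (suc i) = partialProduct α i * α (suc i)

partialProduct≡0⇒∃ : ∀ α i → partialProduct α i ≡ 0 → ∃ λ k → α k ≡ 0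
partialProduct≡0⇒∃ α zero    eq = 0 , eq
partialProduct≡0⇒∃ α (suc i) eq with m*n≡0⇒m≡0∨n≡0 (partialProduct α i) eq
... | inj₁ eq′ = partialProduct≡0⇒∃ α i eq′
... | inj₂ eq′ = suc i , eq′

partialProduct-zero : ∀ α {k} i → α k ≡ 0 → k ≤ i → partialProduct α i ≡ 0
partialProduct-zero α {zero} zero αk≡0 k≤0 = αk≡0
partialProduct-zero α (suc i) αk≡0 k≤1+i with m≤n⇒m<n∨m≡n k≤1+i
... | inj₁ k<1+i = cong (_* α (suc i)) (partialProduct-zero α i αk≡0 (≤-pred k<1+i))
... | inj₂ refl  = trans (cong (partialProduct α i *_) αk≡0) (*-zeroʳ (partialProduct α i))

zero-isolated⇒no-zeros : ∀ α → IsolatedPoint (supportedOnZeros (partialProduct α)) (const 0) →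
                         ∀ k → α k ≢ 0
zero-isolated⇒no-zeros α (n , isolated) k αk≡0 =
  0≢1+n (trans (isolated γ (∈𝓕-supportedOnZeros⁺ γ*p≡0) (n , cong code 0n≡γn) (suc (n + k)))
               (m+n∸n≡m 1 (n + k)))
  where
  -- Truncated subtraction keeps `γ` zero up to `n + k`, hence on the first `n` entries and wherever
  -- the partial product may be nonzero, and gives it the value 1 at `suc (n + k)`.
  γ : 𝒩
  γ i = i ∸ (n + k)

  γ*p≡0 : ∀ i → γ i * partialProduct α i ≡ 0
  γ*p≡0 i with ≤-total i (n + k)
  ... | inj₁ i≤n+k = cong (_* partialProduct α i) (m≤n⇒m∸n≡0 i≤n+k)
  ... | inj₂ n+k≤i =
    trans (cong (γ i *_) (partialProduct-zero α i αk≡0 (m+n≤o⇒n≤o n n+k≤i))) (*-zeroʳ (γ i))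

  0n≡γn : applyUpTo (const 0) n ≡ applyUpTo γ n
  0n≡γn = applyUpTo-cong-< n λ i<n → sym (m≤n⇒m∸n≡0 (≤-trans (<⇒≤ i<n) (m≤m+n n k)))

limit⇒markov : ((β : 𝒩) → Spr β → (α : 𝒩) → α ∈𝓕 β → ¬ IsolatedPoint β α → LimitPoint β α) → MarkovPrinciple
limit⇒markov limit α ¬¬∃ =
  let p = partialProduct α
      -- Length 0 is enough: a nonzero entry of `δ` at any `i` forces the partial product at `i` to
      -- vanish.
      δ , δ∈𝓕 , _ , i , 0≢δᵢ = limit (supportedOnZeros p) (supportedOnZeros-spr p) (const 0)
        (∈𝓕-supportedOnZeros⁺ λ _ → refl)
        (λ isolated → ¬¬∃ λ (k , αk≡0) → zero-isolated⇒no-zeros α isolated k αk≡0) 0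
  in nonzero⇒∃ i (0≢δᵢ ∘ sym) (∈𝓕-supportedOnZeros⁻ δ∈𝓕 i)
  where
  nonzero⇒∃ : ∀ {x} i → x ≢ 0 → x * partialProduct α i ≡ 0 → ∃ λ k → α k ≡ 0
  nonzero⇒∃ {x} i x≢0 eq with m*n≡0⇒m≡0∨n≡0 x eq
  ... | inj₁ x≡0 = contradiction x≡0 x≢0
  ... | inj₂ p≡0 = partialProduct≡0⇒∃ α i p≡0

theorem5p6 : MarkovPrinciple ⇔ ((β : 𝒩) → Spr β → (α : 𝒩) → α ∈𝓕 β → ¬ IsolatedPoint β α → LimitPoint β α)
theorem5p6 = mk⇔ markov⇒limit limit⇒markov
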